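{- Let $a \in \mathbf{F}_q$ be nonzero and let $f(x) \in \mathbf{F}_q[x]$ be an $a$-self reciprocal monic polynomial of even degree. Then $f(x)$ can be written as $f(x) = (x^2-a)^k\cdot g(x)$, where $k \geq 0$ is an integer, $g(x) \in \mathbf{F}_q[x]$ is a nontrivial $a$-self reciprocal monic polynomial not divisible by $x^2-a$, and $k$ is odd if $f(x)$ is trivial, while $k$ is even if $f(x)$ is nontrivial.
   Context: Let $q=p^e$ be an odd prime power and $\mathbf{F}_q$ the finite field with $q$ elements. For a nonzero $a\in\mathbf{F}_q$ and a monic polynomial $f(x)=\sum_{i=0}^n b_i x^i \in \mathbf{F}_q[x]$ of degree $n$ with $f(0)\neq 0$, the $a$-reciprocal of $f$ is $\hat{f}_a(x) := \frac{x^n}{f(0)} f\left(\frac{a}{x}\right) = \frac{1}{b_0}\sum_{i=0}^n b_i a^i x^{n-i}$. A monic polynomial $f(x)$ (with $f(0)\ne 0$) is $a$-self reciprocal if $\hat{f}_a(x)=f(x)$; comparing coefficients gives $b_0^2=a^n$. An $a$-self reciprocal monic polynomial of even degree $n=2m$ ($m \ge 0$) is called trivial if $b_0=-a^m$ and nontrivial if $b_0=a^m$. In particular the constant polynomial $1$ (degree $0$) counts as a nontrivial $a$-self reciprocal monic polynomial. -}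

module Defs where

open import Level using (Level; _⊔_) renaming (suc to lsuc)
open import Algebra.Bundles using (CommutativeRing; RawRing)
open import Algebra.Definitions using (Invertible)
import Algebra.Definitions.RawSemiring as RawSemiringDefs
open import Data.Fin.Base using (Fin; toℕ)
open import Data.List.Base using (List; []; _∷_; map)
open import Data.Nat.Base as ℕ using (ℕ; zero; suc; _∸_; _<_)
import Data.Nat.Divisibility as ℕ∣
open import Data.Nat.Primality using (Prime)
open import Data.Product.Base using (_×_; proj₁; ∃-syntax)
open import Function.Bundles using (Inverse)
open import Relation.Binary.PropositionalEquality using (_≡_; setoid)

OddPrimePower : ℕ → Set
OddPrimePower q = (∃[ p ] ∃[ e ] Prime p × 0 < e × q ≡ p ℕ.^ e) × 2 ℕ∣.∤ q

record Field (c ℓ : Level) : Set (lsuc (c ⊔ ℓ)) where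
  field
    commutativeRing : CommutativeRing c ℓ

  open CommutativeRing commutativeRing public

  field
    1≉0        : 1# ≉ 0#
    invertible : ∀ {x} → x ≉ 0# → Invertible _≈_ 1# _*_ x

HasCardinality : ∀ {c ℓ} → Field c ℓ → ℕ → Set (c ⊔ ℓ)
HasCardinality F q = Inverse (Field.setoid F) (setoid (Fin q))

-- Polynomials are lists of coefficients, constant term first. Trailing
-- zeros are allowed, so F[x] is the setoid given by _≈ₚ_.

module Polynomial {c ℓ} (R : CommutativeRing c ℓ) where
  open CommutativeRing R

  Poly : Set c
  Poly = List Carrier

  coeff : Poly → ℕ → Carrier
  coeff []      _       = 0#
  coeff (b ∷ f) zero    = b
  coeff (b ∷ f) (suc i) = coeff f i

  infix 4 _≈ₚ_
  _≈ₚ_ : Poly → Poly → Set ℓ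
  f ≈ₚ g = ∀ i → coeff f i ≈ coeff g i

  C : Carrier → Poly
  C b = b ∷ []

  X : Poly
  X = 0# ∷ 1# ∷ []

  infixl 6 _+ₚ_ _-ₚ_
  infixl 7 _*ₚ_
  infix  8 -ₚ_

  _+ₚ_ : Poly → Poly → Poly
  []      +ₚ g       = g
  (b ∷ f) +ₚ []      = b ∷ f
  (b ∷ f) +ₚ (d ∷ g) = (b + d) ∷ (f +ₚ g)

  -ₚ_ : Poly → Poly
  -ₚ f = map (λ b → - b) f

  _-ₚ_ : Poly → Poly → Poly
  f -ₚ g = f +ₚ (-ₚ g)

  -- (b + x f) g = b g + x (f g)
  _*ₚ_ : Poly → Poly → Poly
  []      *ₚ g = []
  (b ∷ f) *ₚ g = map (b *_) g +ₚ (0# ∷ (f *ₚ g))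

  polyRawRing : RawRing c ℓ
  polyRawRing = record
    { Carrier = Poly
    ; _≈_     = _≈ₚ_
    ; _+_     = _+ₚ_
    ; _*_     = _*ₚ_
    ; -_      = -ₚ_
    ; 0#      = []
    ; 1#      = C 1#
    }

  open RawSemiringDefs (RawRing.rawSemiring polyRawRing) public
    using ()
    renaming (_^_ to _^ₚ_; sum to sumₚ; _∣_ to _∣ₚ_; _∤_ to _∤ₚ_)

  record MonicOfDegree (n : ℕ) (f : Poly) : Set ℓ where
    field
      leading : coeff f n ≈ 1#
      above   : ∀ i → n < i → coeff f i ≈ 0#

module SelfReciprocal {c ℓ} (F : Field c ℓ) where
  open Field F
  open Polynomial commutativeRing public
  open RawSemiringDefs (RawRing.rawSemiring rawRing) using (_^_)

  -- (1 / b₀) ∑_{i=0}^{n} bᵢ aⁱ xⁿ⁻ⁱ, where n is meant to be the degree of f.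
  reciprocal : Carrier → ℕ → (f : Poly) → coeff f 0 ≉ 0# → Poly
  reciprocal a n f b₀≉0 =
    C (proj₁ (invertible b₀≉0)) *ₚ
    sumₚ {suc n} (λ i → C (coeff f (toℕ i) * a ^ toℕ i) *ₚ X ^ₚ (n ∸ toℕ i))

  record SelfReciprocalMonic (a : Carrier) (n : ℕ) (f : Poly) : Set ℓ where
    field
      monic          : MonicOfDegree n f
      f[0]≉0         : coeff f 0 ≉ 0#
      selfReciprocal : reciprocal a n f f[0]≉0 ≈ₚ f

  Trivial : Carrier → Poly → Set ℓ
  Trivial a f = ∃[ m ] SelfReciprocalMonic a (2 ℕ.* m) f × coeff f 0 ≈ - (a ^ m)

  Nontrivial : Carrier → Poly → Set ℓ
  Nontrivial a f = ∃[ m ] SelfReciprocalMonic a (2 ℕ.* m) f × coeff f 0 ≈ a ^ m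

module Submission where

-- Comparing coefficients, f of degree n is a-self reciprocal iff bᵢ aⁱ = b₀ bⱼ whenever
-- i + j = n. If f is trivial, n = 2m, this law makes the terms of ∑ b₂ⱼ aʲ and of
-- ∑ b₂ⱼ₊₁ aʲ cancel in pairs under j ↦ m − j and j ↦ m − 1 − j, so in odd characteristic
-- both sums vanish; they are the coefficients of the remainder of f modulo x² − a, so
-- x² − a divides f. Whenever f = (x² − a) g, the quotient g satisfies the same law in
-- degree n − 2, and b₀ = −a g(0) shows that g is trivial exactly when f is not. Dividing
-- by x² − a as long as possible therefore ends at a nontrivial polynomial, and the parity
-- of the number of divisions is determined by f.

open import Defs
open import Level using (Level; _⊔_)
open import Algebra.Bundles using (CommutativeRing)
open import Algebra.Definitions.RawMagma using (_,_)
import Algebra.Properties.CommutativeMonoid.Sum as Sums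
import Algebra.Properties.CommutativeSemigroup as CommutativeSemigroupProperties
import Algebra.Properties.Group as GroupProperties
import Algebra.Properties.Monoid.Mult as Multiples
import Algebra.Properties.Ring as RingProperties
import Algebra.Properties.Semiring.Exp as Exponentiation
import Algebra.Properties.Semiring.Mult as SemiringMultiples
import Algebra.Properties.Semiring.Sum as SemiringSum
import Algebra.Solver.Ring.NaturalCoefficients.Default as SemiringSolver
open import Data.Fin.Base using (Fin; toℕ; opposite)
open import Data.Fin.Permutation using (permutation; reverse)
open import Data.Fin.Properties as Fin using ()
open import Data.List.Base using ([]; _∷_; map)
open import Data.Nat.Base as ℕ using (ℕ; zero; suc; _<_; _≤_; z≤n; s≤s; _∸_)
open import Data.Nat.Divisibility using (_∣_; _∤_; divides)
import Data.Nat.Divisibility as ℕ∣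
import Data.Nat.DivMod as ℕ/
import Data.Nat.Properties as ℕ
open import Data.Product.Base as Product using (_×_; _,_; proj₁; proj₂; ∃-syntax)
open import Data.Sum.Base using (_⊎_; inj₁; inj₂)
open import Function.Base using (_∘_)
open import Function.Bundles using (Inverse)
open import Function.Properties.Inverse using (Inverse⇒Injection)
open import Relation.Binary.Definitions using (Decidable; tri<; tri≈; tri>)
open import Relation.Binary.PropositionalEquality as ≡ using (_≡_)
import Relation.Binary.Reasoning.Setoid as SetoidReasoning
open import Relation.Nullary using (¬_; yes; no; contradiction)
import Relation.Nullary.Decidable as Dec

private variable
  c ℓ : Level

-- Coefficients of sums and products of polynomials.

module PolynomialProperties (R : CommutativeRing c ℓ) where
  open CommutativeRing R hiding (zero)
  open Polynomial R
  open SemiringSolver commutativeSemiring using (solve; _:=_; _:+_; _:*_)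
  open SetoidReasoning setoid

  coeff-+ : ∀ f g i → coeff (f +ₚ g) i ≈ coeff f i + coeff g i
  coeff-+ []      g       i       = sym (+-identityˡ _)
  coeff-+ (b ∷ f) []      i       = sym (+-identityʳ _)
  coeff-+ (b ∷ f) (d ∷ g) zero    = refl
  coeff-+ (b ∷ f) (d ∷ g) (suc i) = coeff-+ f g i

  coeff-scale : ∀ b g i → coeff (map (b *_) g) i ≈ b * coeff g i
  coeff-scale b []      i       = sym (zeroʳ b)
  coeff-scale b (d ∷ g) zero    = refl
  coeff-scale b (d ∷ g) (suc i) = coeff-scale b g i

  coeff-*-zero : ∀ b f g → coeff ((b ∷ f) *ₚ g) 0 ≈ b * coeff g 0
  coeff-*-zero b f g = begin
    coeff (map (b *_) g +ₚ (0# ∷ f *ₚ g)) 0  ≈⟨ coeff-+ (map (b *_) g) _ 0 ⟩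
    coeff (map (b *_) g) 0 + 0#              ≈⟨ +-identityʳ _ ⟩
    coeff (map (b *_) g) 0                   ≈⟨ coeff-scale b g 0 ⟩
    b * coeff g 0                            ∎

  coeff-*-suc : ∀ b f g i →
    coeff ((b ∷ f) *ₚ g) (suc i) ≈ b * coeff g (suc i) + coeff (f *ₚ g) i
  coeff-*-suc b f g i =
    trans (coeff-+ (map (b *_) g) _ (suc i)) (+-congʳ (coeff-scale b g (suc i)))

  coeff-C* : ∀ b g i → coeff (C b *ₚ g) i ≈ b * coeff g i
  coeff-C* b g zero    = coeff-*-zero b [] g
  coeff-C* b g (suc i) = trans (coeff-*-suc b [] g i) (+-identityʳ _)

  coeff-X*-zero : ∀ g → coeff (X *ₚ g) 0 ≈ 0#
  coeff-X*-zero g = trans (coeff-*-zero 0# (C 1#) g) (zeroˡ _)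

  coeff-X*-suc : ∀ g i → coeff (X *ₚ g) (suc i) ≈ coeff g i
  coeff-X*-suc g i = begin
    coeff (X *ₚ g) (suc i)                       ≈⟨ coeff-*-suc 0# (C 1#) g i ⟩
    0# * coeff g (suc i) + coeff (C 1# *ₚ g) i   ≈⟨ +-cong (zeroˡ _) (coeff-C* 1# g i) ⟩
    0# + 1# * coeff g i                          ≈⟨ +-identityˡ _ ⟩
    1# * coeff g i                               ≈⟨ *-identityˡ _ ⟩
    coeff g i                                    ∎

  coeff-X^-≡ : ∀ n → coeff (X ^ₚ n) n ≈ 1#
  coeff-X^-≡ zero    = refl
  coeff-X^-≡ (suc n) = trans (coeff-X*-suc (X ^ₚ n) n) (coeff-X^-≡ n)

  coeff-X^-≢ : ∀ n i → ¬ n ≡ i → coeff (X ^ₚ n) i ≈ 0#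
  coeff-X^-≢ zero    zero    n≢i = contradiction ≡.refl n≢i
  coeff-X^-≢ zero    (suc i) n≢i = refl
  coeff-X^-≢ (suc n) zero    n≢i = coeff-X*-zero (X ^ₚ n)
  coeff-X^-≢ (suc n) (suc i) n≢i =
    trans (coeff-X*-suc (X ^ₚ n) i) (coeff-X^-≢ n i (n≢i ∘ ≡.cong suc))

  *ₚ-congˡ : ∀ f {g g′} → g ≈ₚ g′ → f *ₚ g ≈ₚ f *ₚ g′
  *ₚ-congˡ []      g≈g′ i = refl
  *ₚ-congˡ (b ∷ f) {g} {g′} g≈g′ zero = begin
    coeff ((b ∷ f) *ₚ g) 0   ≈⟨ coeff-*-zero b f g ⟩
    b * coeff g 0            ≈⟨ *-congˡ (g≈g′ 0) ⟩
    b * coeff g′ 0           ≈⟨ coeff-*-zero b f g′ ⟨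
    coeff ((b ∷ f) *ₚ g′) 0  ∎
  *ₚ-congˡ (b ∷ f) {g} {g′} g≈g′ (suc i) = begin
    coeff ((b ∷ f) *ₚ g) (suc i)               ≈⟨ coeff-*-suc b f g i ⟩
    b * coeff g (suc i) + coeff (f *ₚ g) i     ≈⟨ +-cong (*-congˡ (g≈g′ (suc i))) (*ₚ-congˡ f g≈g′ i) ⟩
    b * coeff g′ (suc i) + coeff (f *ₚ g′) i   ≈⟨ coeff-*-suc b f g′ i ⟨
    coeff ((b ∷ f) *ₚ g′) (suc i)              ∎

  coeff-*-+ : ∀ f g h i →
    coeff ((f +ₚ g) *ₚ h) i ≈ coeff (f *ₚ h) i + coeff (g *ₚ h) i
  coeff-*-+ []      g       h i = sym (+-identityˡ _)
  coeff-*-+ (b ∷ f) []      h i = sym (+-identityʳ _)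
  coeff-*-+ (b ∷ f) (d ∷ g) h zero = begin
    coeff ((b + d ∷ f +ₚ g) *ₚ h) 0                    ≈⟨ coeff-*-zero (b + d) (f +ₚ g) h ⟩
    (b + d) * coeff h 0                                ≈⟨ distribʳ _ b d ⟩
    b * coeff h 0 + d * coeff h 0                      ≈⟨ +-cong (coeff-*-zero b f h) (coeff-*-zero d g h) ⟨
    coeff ((b ∷ f) *ₚ h) 0 + coeff ((d ∷ g) *ₚ h) 0    ∎
  coeff-*-+ (b ∷ f) (d ∷ g) h (suc i) = begin
    coeff ((b + d ∷ f +ₚ g) *ₚ h) (suc i)
      ≈⟨ coeff-*-suc (b + d) (f +ₚ g) h i ⟩
    (b + d) * coeff h (suc i) + coeff ((f +ₚ g) *ₚ h) i
      ≈⟨ +-congˡ (coeff-*-+ f g h i) ⟩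
    (b + d) * coeff h (suc i) + (coeff (f *ₚ h) i + coeff (g *ₚ h) i)
      ≈⟨ solve 5 (λ b d x u v → (b :+ d) :* x :+ (u :+ v) := (b :* x :+ u) :+ (d :* x :+ v))
           refl b d _ _ _ ⟩
    (b * coeff h (suc i) + coeff (f *ₚ h) i) + (d * coeff h (suc i) + coeff (g *ₚ h) i)
      ≈⟨ +-cong (coeff-*-suc b f h i) (coeff-*-suc d g h i) ⟨
    coeff ((b ∷ f) *ₚ h) (suc i) + coeff ((d ∷ g) *ₚ h) (suc i)
      ∎

  coeff-scale-* : ∀ b f g i → coeff (map (b *_) f *ₚ g) i ≈ b * coeff (f *ₚ g) i
  coeff-scale-* b []      g i = sym (zeroʳ b)
  coeff-scale-* b (d ∷ f) g zero = begin
    coeff ((b * d ∷ map (b *_) f) *ₚ g) 0  ≈⟨ coeff-*-zero (b * d) (map (b *_) f) g ⟩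
    b * d * coeff g 0                      ≈⟨ *-assoc b d _ ⟩
    b * (d * coeff g 0)                    ≈⟨ *-congˡ (coeff-*-zero d f g) ⟨
    b * coeff ((d ∷ f) *ₚ g) 0             ∎
  coeff-scale-* b (d ∷ f) g (suc i) = begin
    coeff ((b * d ∷ map (b *_) f) *ₚ g) (suc i)              ≈⟨ coeff-*-suc (b * d) (map (b *_) f) g i ⟩
    b * d * coeff g (suc i) + coeff (map (b *_) f *ₚ g) i    ≈⟨ +-cong (*-assoc b d _) (coeff-scale-* b f g i) ⟩
    b * (d * coeff g (suc i)) + b * coeff (f *ₚ g) i         ≈⟨ distribˡ b _ _ ⟨
    b * (d * coeff g (suc i) + coeff (f *ₚ g) i)             ≈⟨ *-congˡ (coeff-*-suc d f g i) ⟨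
    b * coeff ((d ∷ f) *ₚ g) (suc i)                         ∎

  *ₚ-assoc : ∀ f g h → (f *ₚ g) *ₚ h ≈ₚ f *ₚ (g *ₚ h)
  *ₚ-assoc []      g h i = refl
  *ₚ-assoc (b ∷ f) g h zero = begin
    coeff ((map (b *_) g +ₚ (0# ∷ f *ₚ g)) *ₚ h) 0
      ≈⟨ coeff-*-+ (map (b *_) g) _ h 0 ⟩
    coeff (map (b *_) g *ₚ h) 0 + coeff ((0# ∷ f *ₚ g) *ₚ h) 0
      ≈⟨ +-cong (coeff-scale-* b g h 0) (trans (coeff-*-zero 0# (f *ₚ g) h) (zeroˡ _)) ⟩
    b * coeff (g *ₚ h) 0 + 0#
      ≈⟨ +-identityʳ _ ⟩
    b * coeff (g *ₚ h) 0
      ≈⟨ coeff-*-zero b f (g *ₚ h) ⟨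
    coeff ((b ∷ f) *ₚ (g *ₚ h)) 0
      ∎
  *ₚ-assoc (b ∷ f) g h (suc i) = begin
    coeff ((map (b *_) g +ₚ (0# ∷ f *ₚ g)) *ₚ h) (suc i)
      ≈⟨ coeff-*-+ (map (b *_) g) _ h (suc i) ⟩
    coeff (map (b *_) g *ₚ h) (suc i) + coeff ((0# ∷ f *ₚ g) *ₚ h) (suc i)
      ≈⟨ +-cong (coeff-scale-* b g h (suc i)) (coeff-*-suc 0# (f *ₚ g) h i) ⟩
    b * coeff (g *ₚ h) (suc i) + (0# * coeff h (suc i) + coeff ((f *ₚ g) *ₚ h) i)
      ≈⟨ +-congˡ (trans (+-congʳ (zeroˡ _)) (+-identityˡ _)) ⟩
    b * coeff (g *ₚ h) (suc i) + coeff ((f *ₚ g) *ₚ h) i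
      ≈⟨ +-congˡ (*ₚ-assoc f g h i) ⟩
    b * coeff (g *ₚ h) (suc i) + coeff (f *ₚ (g *ₚ h)) i
      ≈⟨ coeff-*-suc b f (g *ₚ h) i ⟨
    coeff ((b ∷ f) *ₚ (g *ₚ h)) (suc i)
      ∎

  coeff-*[] : ∀ f i → coeff (f *ₚ []) i ≈ 0#
  coeff-*[] []      i       = refl
  coeff-*[] (b ∷ f) zero    = refl
  coeff-*[] (b ∷ f) (suc i) = coeff-*[] f i

  -- `*ₚ` recurses on its first factor only. This lemma and the next give the mirrored recursion on
  -- the second factor, which turns commutativity into a single induction.
  coeff-*∷-zero : ∀ f d g → coeff (f *ₚ (d ∷ g)) 0 ≈ d * coeff f 0
  coeff-*∷-zero []      d g = sym (zeroʳ d)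
  coeff-*∷-zero (b ∷ f) d g = trans (coeff-*-zero b f (d ∷ g)) (*-comm b d)

  coeff-*∷-suc : ∀ f d g i →
    coeff (f *ₚ (d ∷ g)) (suc i) ≈ d * coeff f (suc i) + coeff (f *ₚ g) i
  coeff-*∷-suc []      d g i = sym (trans (+-identityʳ _) (zeroʳ d))
  coeff-*∷-suc (b ∷ f) d g zero = begin
    coeff ((b ∷ f) *ₚ (d ∷ g)) 1                       ≈⟨ coeff-*-suc b f (d ∷ g) 0 ⟩
    b * coeff g 0 + coeff (f *ₚ (d ∷ g)) 0             ≈⟨ +-cong (sym (coeff-*-zero b f g)) (coeff-*∷-zero f d g) ⟩
    coeff ((b ∷ f) *ₚ g) 0 + d * coeff f 0             ≈⟨ +-comm _ _ ⟩
    d * coeff f 0 + coeff ((b ∷ f) *ₚ g) 0             ∎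
  coeff-*∷-suc (b ∷ f) d g (suc i) = begin
    coeff ((b ∷ f) *ₚ (d ∷ g)) (suc (suc i))
      ≈⟨ coeff-*-suc b f (d ∷ g) (suc i) ⟩
    b * coeff g (suc i) + coeff (f *ₚ (d ∷ g)) (suc i)
      ≈⟨ +-congˡ (coeff-*∷-suc f d g i) ⟩
    b * coeff g (suc i) + (d * coeff f (suc i) + coeff (f *ₚ g) i)
      ≈⟨ solve 3 (λ x y z → x :+ (y :+ z) := y :+ (x :+ z)) refl _ _ _ ⟩
    d * coeff f (suc i) + (b * coeff g (suc i) + coeff (f *ₚ g) i)
      ≈⟨ +-congˡ (coeff-*-suc b f g i) ⟨
    d * coeff f (suc i) + coeff ((b ∷ f) *ₚ g) (suc i)
      ∎

  *ₚ-comm : ∀ f g → f *ₚ g ≈ₚ g *ₚ f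
  *ₚ-comm []      g i       = sym (coeff-*[] g i)
  *ₚ-comm (b ∷ f) g zero    = trans (coeff-*-zero b f g) (sym (coeff-*∷-zero g b f))
  *ₚ-comm (b ∷ f) g (suc i) = begin
    coeff ((b ∷ f) *ₚ g) (suc i)            ≈⟨ coeff-*-suc b f g i ⟩
    b * coeff g (suc i) + coeff (f *ₚ g) i  ≈⟨ +-congˡ (*ₚ-comm f g i) ⟩
    b * coeff g (suc i) + coeff (g *ₚ f) i  ≈⟨ coeff-*∷-suc g b f i ⟨
    coeff (g *ₚ (b ∷ f)) (suc i)            ∎

  -- Exactly one term, the one with index i = n - j, reaches exponent j. Writing this as i + j ≡ n
  -- lets the induction peel off the first term: either it is the one sought and the tail has lower
  -- degree, or it misses j and the tail is the same sum for n - 1 with β shifted.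
  coeff-∑CX^ : ∀ n (β : ℕ → Carrier) i j → i ℕ.+ j ≡ n →
    coeff (sumₚ {suc n} (λ k → C (β (toℕ k)) *ₚ X ^ₚ (n ∸ toℕ k))) j ≈ β i
  coeff-∑CX^->  : ∀ n (β : ℕ → Carrier) j → n < j →
    coeff (sumₚ {suc n} (λ k → C (β (toℕ k)) *ₚ X ^ₚ (n ∸ toℕ k))) j ≈ 0#

  coeff-∑CX^ zero β zero zero i+j≡n =
    trans (coeff-+ (C (β 0) *ₚ C 1#) [] 0)
          (trans (+-identityʳ _) (trans (coeff-C* (β 0) (C 1#) 0) (*-identityʳ _)))
  coeff-∑CX^ (suc n) β zero j ≡.refl = begin
    coeff (C (β 0) *ₚ X ^ₚ suc n +ₚ s) (suc n)
      ≈⟨ coeff-+ (C (β 0) *ₚ X ^ₚ suc n) _ (suc n) ⟩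
    coeff (C (β 0) *ₚ X ^ₚ suc n) (suc n) + coeff s (suc n)
      ≈⟨ +-cong (coeff-C* (β 0) (X ^ₚ suc n) (suc n)) (coeff-∑CX^-> n (β ∘ suc) (suc n) ℕ.≤-refl) ⟩
    β 0 * coeff (X ^ₚ suc n) (suc n) + 0#
      ≈⟨ +-identityʳ _ ⟩
    β 0 * coeff (X ^ₚ suc n) (suc n)
      ≈⟨ *-congˡ (coeff-X^-≡ (suc n)) ⟩
    β 0 * 1#
      ≈⟨ *-identityʳ _ ⟩
    β 0
      ∎
    where s = sumₚ {suc n} (λ k → C (β (suc (toℕ k))) *ₚ X ^ₚ (n ∸ toℕ k))
  coeff-∑CX^ (suc n) β (suc i) j i+j≡n = begin
    coeff (C (β 0) *ₚ X ^ₚ suc n +ₚ s) j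
      ≈⟨ coeff-+ (C (β 0) *ₚ X ^ₚ suc n) _ j ⟩
    coeff (C (β 0) *ₚ X ^ₚ suc n) j + coeff s j
      ≈⟨ +-cong (coeff-C* (β 0) (X ^ₚ suc n) j) (coeff-∑CX^ n (β ∘ suc) i j (ℕ.suc-injective i+j≡n)) ⟩
    β 0 * coeff (X ^ₚ suc n) j + β (suc i)
      ≈⟨ +-congʳ (trans (*-congˡ (coeff-X^-≢ (suc n) j (ℕ.>⇒≢ j<n))) (zeroʳ _)) ⟩
    0# + β (suc i)
      ≈⟨ +-identityˡ _ ⟩
    β (suc i)
      ∎
    where
    s = sumₚ {suc n} (λ k → C (β (suc (toℕ k))) *ₚ X ^ₚ (n ∸ toℕ k))
    j<n : j < suc n
    j<n = ≡.subst (j <_) i+j≡n (s≤s (ℕ.m≤n+m j i))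

  coeff-∑CX^-> zero β (suc j) n<j =
    trans (coeff-+ (C (β 0) *ₚ C 1#) [] (suc j)) (+-identityʳ _)
  coeff-∑CX^-> (suc n) β j n<j = begin
    coeff (C (β 0) *ₚ X ^ₚ suc n +ₚ s) j
      ≈⟨ coeff-+ (C (β 0) *ₚ X ^ₚ suc n) _ j ⟩
    coeff (C (β 0) *ₚ X ^ₚ suc n) j + coeff s j
      ≈⟨ +-cong (coeff-C* (β 0) (X ^ₚ suc n) j) (coeff-∑CX^-> n (β ∘ suc) j (ℕ.<-trans (ℕ.n<1+n n) n<j)) ⟩
    β 0 * coeff (X ^ₚ suc n) j + 0#
      ≈⟨ +-identityʳ _ ⟩
    β 0 * coeff (X ^ₚ suc n) j
      ≈⟨ *-congˡ (coeff-X^-≢ (suc n) j (ℕ.<⇒≢ n<j)) ⟩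
    β 0 * 0#
      ≈⟨ zeroʳ _ ⟩
    0#
      ∎
    where s = sumₚ {suc n} (λ k → C (β (suc (toℕ k))) *ₚ X ^ₚ (n ∸ toℕ k))

  -- If the degrees differed, the leading 1 of the larger would lie where the smaller forces 0. This
  -- identifies the half-degrees that `Trivial` and `Nontrivial` each quantify separately.
  monic-degree-unique : ¬ 1# ≈ 0# → ∀ {m n f} →
    MonicOfDegree m f → MonicOfDegree n f → m ≡ n
  monic-degree-unique 1≉0 {m} {n} p q with ℕ.<-cmp m n
  ... | tri< m<n _ _ =
    contradiction (trans (sym (MonicOfDegree.leading q)) (MonicOfDegree.above p n m<n)) 1≉0
  ... | tri≈ _ m≡n _ = m≡n
  ... | tri> _ _ n<m =
    contradiction (trans (sym (MonicOfDegree.leading p)) (MonicOfDegree.above q m n<m)) 1≉0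

-- Division with remainder by x² - a.

module DivisionByX²-a (R : CommutativeRing c ℓ) (a : CommutativeRing.Carrier R) where
  open CommutativeRing R hiding (zero)
  open Polynomial R
  open PolynomialProperties R
  open GroupProperties +-group using (∙-cancelʳ)
  open Exponentiation semiring using (_^_)
  open Sums +-commutativeMonoid using (sum; sum-cong-≋)
  open SemiringSum semiring using (*-distribˡ-sum)
  open SetoidReasoning setoid

  X²-a : Poly
  X²-a = X ^ₚ 2 -ₚ C a

  -- Multiplication by x² shifts the list by two places, and the summand a gᵢ cancels the
  -- contribution of -a. This links the product to an equation free of negation.
  coeff-X²-a* : ∀ g i → coeff (X²-a *ₚ g) i + a * coeff g i ≈ coeff (0# ∷ 0# ∷ g) i
  coeff-X²-a* g i = begin
    coeff (X²-a *ₚ g) i + a * coeff g i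
      ≈⟨ +-congʳ (coeff-*-+ (X ^ₚ 2) (C (- a)) g i) ⟩
    coeff (X ^ₚ 2 *ₚ g) i + coeff (C (- a) *ₚ g) i + a * coeff g i
      ≈⟨ +-assoc _ _ _ ⟩
    coeff (X ^ₚ 2 *ₚ g) i + (coeff (C (- a) *ₚ g) i + a * coeff g i)
      ≈⟨ +-cong (X²* i) (+-congʳ (coeff-C* (- a) g i)) ⟩
    coeff (0# ∷ 0# ∷ g) i + (- a * coeff g i + a * coeff g i)
      ≈⟨ +-congˡ (distribʳ _ (- a) a) ⟨
    coeff (0# ∷ 0# ∷ g) i + (- a + a) * coeff g i
      ≈⟨ +-congˡ (trans (*-congʳ (-‿inverseˡ a)) (zeroˡ _)) ⟩
    coeff (0# ∷ 0# ∷ g) i + 0#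
      ≈⟨ +-identityʳ _ ⟩
    coeff (0# ∷ 0# ∷ g) i
      ∎
    where
    -- `X ^ₚ 2` unfolds to `X *ₚ (X *ₚ C 1#)`, so a final factor 1 has to be removed as well.
    X*X* : ∀ i → coeff (X *ₚ ((X *ₚ C 1#) *ₚ g)) i ≈ coeff (0# ∷ 0# ∷ g) i
    X*X* zero          = coeff-X*-zero ((X *ₚ C 1#) *ₚ g)
    X*X* (suc i)       = trans (coeff-X*-suc ((X *ₚ C 1#) *ₚ g) i) (trans (*ₚ-assoc X (C 1#) g i) (X*1* i))
      where
      X*1* : ∀ i → coeff (X *ₚ (C 1# *ₚ g)) i ≈ coeff (0# ∷ g) i
      X*1* zero    = coeff-X*-zero (C 1# *ₚ g)
      X*1* (suc i) = trans (coeff-X*-suc (C 1# *ₚ g) i) (trans (coeff-C* 1# g i) (*-identityˡ _))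
    X²* : ∀ i → coeff (X ^ₚ 2 *ₚ g) i ≈ coeff (0# ∷ 0# ∷ g) i
    X²* i = trans (*ₚ-assoc X (X *ₚ C 1#) g i) (X*X* i)

  -- The coefficientwise form of f = (x² − a) g, with the negative term moved to the left.
  record _≈X²-a*_ (f g : Poly) : Set ℓ where
    constructor mk
    field equation : ∀ i → coeff f i + a * coeff g i ≈ coeff (0# ∷ 0# ∷ g) i
  open _≈X²-a*_ public

  ≈X²-a*⇒≈ : ∀ {f g} → f ≈X²-a* g → f ≈ₚ X²-a *ₚ g
  ≈X²-a*⇒≈ {f} {g} f≈ i =
    ∙-cancelʳ (a * coeff g i) _ _ (trans (equation f≈ i) (sym (coeff-X²-a* g i)))

  ≈⇒≈X²-a* : ∀ {f g} → f ≈ₚ X²-a *ₚ g → f ≈X²-a* g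
  ≈⇒≈X²-a* {f} {g} f≈ = mk λ i → trans (+-congʳ (f≈ i)) (coeff-X²-a* g i)

  -- The remainder of f modulo x² − a is even f + odd f x.
  even odd : Poly → Carrier
  even []      = 0#
  even (b ∷ f) = b + a * odd f
  odd []       = 0#
  odd (b ∷ f)  = even f

  -- The coefficient of xⁱ is bᵢ₊₂ + a bᵢ₊₄ + a² bᵢ₊₆ + ⋯, as in Horner's scheme.
  quotient : Poly → Poly
  quotient []      = []
  quotient (b ∷ f) = odd f ∷ quotient f

  -- The tail of the right-hand list for `b ∷ f` is the right-hand list for `f`, so only the
  -- constant term needs attention, and there the equation is the definition of `even`.
  division : ∀ f i →
    coeff f i + a * coeff (quotient f) i ≈ coeff (even f ∷ odd f ∷ quotient f) i
  division []      zero          = trans (+-identityˡ _) (zeroʳ a)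
  division []      (suc zero)    = trans (+-identityˡ _) (zeroʳ a)
  division []      (suc (suc i)) = trans (+-identityˡ _) (zeroʳ a)
  division (b ∷ f) zero          = refl
  division (b ∷ f) (suc i)       = division f i

  -- Iterating uᵢ = a uᵢ₊₂ runs past the end of the list. This finiteness argument bounds the degree
  -- of quotients, whose lists may carry trailing zeros.
  eventually-zero : ∀ u d → (∀ i → d ≤ i → coeff u i ≈ a * coeff u (2 ℕ.+ i)) →
    ∀ i → d ≤ i → coeff u i ≈ 0#
  eventually-zero []      d       eq i       d≤i       = refl
  eventually-zero (b ∷ u) (suc d) eq (suc i) (s≤s d≤i) =
    eventually-zero u d (λ j d≤j → eq (suc j) (s≤s d≤j)) i d≤i
  eventually-zero (b ∷ u) zero    eq (suc i) _         =
    eventually-zero u zero (λ j _ → eq (suc j) z≤n) i z≤n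
  eventually-zero (b ∷ u) zero    eq zero    _         = begin
    b              ≈⟨ eq 0 z≤n ⟩
    a * coeff u 1  ≈⟨ *-congˡ (eventually-zero u zero (λ j _ → eq (suc j) z≤n) 1 z≤n) ⟩
    a * 0#         ≈⟨ zeroʳ a ⟩
    0#             ∎

  -- Dropping the constant terms turns the equation for remainder (r, s) into one of the same shape
  -- for the tails, with remainder (s, d), where d is the head of g. Once f is exhausted, the
  -- equation says gᵢ = a gᵢ₊₂, hence g = 0.
  remainder-unique : ∀ f g r s →
    (∀ i → coeff f i + a * coeff g i ≈ coeff (r ∷ s ∷ g) i) → even f ≈ r × odd f ≈ s
  remainder-unique [] g r s eq =
    trans (sym (eq′ 0)) (eq 0) , trans (sym (eq′ 1)) (eq 1)
    where
    g≈0 : ∀ i → coeff g i ≈ 0#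
    g≈0 i = eventually-zero g 0
      (λ j _ → trans (sym (eq (2 ℕ.+ j))) (+-identityˡ _)) i z≤n
    eq′ : ∀ i → 0# + a * coeff g i ≈ 0#
    eq′ i = trans (+-identityˡ _) (trans (*-congˡ (g≈0 i)) (zeroʳ a))
  -- An empty g counts as having head 0. The lists `s ∷ []` and `s ∷ 0# ∷ []` agree only coefficient
  -- by coefficient, hence the case split.
  remainder-unique (b ∷ f) [] r s eq with
    remainder-unique f [] s 0# (λ { zero → eq 1 ; (suc zero) → eq 2 ; (suc (suc i)) → eq (3 ℕ.+ i) })
  ... | even≈s , odd≈0 = trans (+-congˡ (*-congˡ odd≈0)) (eq 0) , even≈s
  remainder-unique (b ∷ f) (d ∷ g) r s eq with remainder-unique f g s d (eq ∘ suc)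
  ... | even≈s , odd≈d = trans (+-congˡ (*-congˡ odd≈d)) (eq 0) , even≈s

  quotient-exact : ∀ f → even f ≈ 0# → odd f ≈ 0# → f ≈X²-a* quotient f
  quotient-exact f even≈0 odd≈0 = mk λ where
    zero          → trans (division f 0) even≈0
    (suc zero)    → trans (division f 1) odd≈0
    (suc (suc i)) → division f (2 ℕ.+ i)

  divisible⇒remainder≈0 : ∀ {f} → X²-a ∣ₚ f → even f ≈ 0# × odd f ≈ 0#
  divisible⇒remainder≈0 {f} (g , gh≈f) = remainder-unique f g 0# 0# (equation (≈⇒≈X²-a* {f}
    -- `_∣ₚ_` places the cofactor on the left.
    λ i → trans (sym (gh≈f i)) (*ₚ-comm g X²-a i)))

  -- Divisibility amounts to the vanishing of the two remainder coefficients, which decidable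
  -- equality can test.
  X²-a∣? : Decidable _≈_ → ∀ f → (∃[ g ] f ≈X²-a* g) ⊎ X²-a ∤ₚ f
  X²-a∣? _≟_ f with even f ≟ 0# | odd f ≟ 0#
  ... | yes even≈0 | yes odd≈0 = inj₁ (quotient f , quotient-exact f even≈0 odd≈0)
  ... | no  even≉0 | _         = inj₂ (even≉0 ∘ proj₁ ∘ divisible⇒remainder≈0)
  ... | yes _      | no odd≉0  = inj₂ (odd≉0 ∘ proj₂ ∘ divisible⇒remainder≈0)

  -- Horner's scheme unrolled. The cutoff N is any bound beyond which the coefficients vanish; each
  -- removed coefficient swaps the roles of `even` and `odd`.
  even-∑ : ∀ N f → (∀ i → N ℕ.* 2 ≤ i → coeff f i ≈ 0#) →
    even f ≈ sum {N} (λ j → coeff f (toℕ j ℕ.* 2) * a ^ toℕ j)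
  odd-∑  : ∀ N f → (∀ i → suc (N ℕ.* 2) ≤ i → coeff f i ≈ 0#) →
    odd f ≈ sum {N} (λ j → coeff f (suc (toℕ j ℕ.* 2)) * a ^ toℕ j)

  even-∑ zero    []      f≈0 = refl
  even-∑ zero    (b ∷ f) f≈0 = begin
    b + a * odd f  ≈⟨ +-cong (f≈0 0 z≤n) (*-congˡ (odd-∑ zero f λ i _ → f≈0 (suc i) z≤n)) ⟩
    0# + a * 0#    ≈⟨ trans (+-identityˡ _) (zeroʳ a) ⟩
    0#             ∎
  even-∑ (suc N) []      f≈0 = sym (begin
    sum {suc N} (λ j → 0# * a ^ toℕ j)  ≈⟨ sum-cong-≋ {suc N} (λ j → zeroˡ (a ^ toℕ j)) ⟩
    sum {suc N} (λ j → 0#)              ≈⟨ Sums.sum-replicate-zero +-commutativeMonoid (suc N) ⟩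
    0#                                  ∎)
  even-∑ (suc N) (b ∷ f) f≈0 = begin
    b + a * odd f
      ≈⟨ +-cong (sym (*-identityʳ b)) (*-congˡ (odd-∑ N f λ i N≤i → f≈0 (suc i) (s≤s N≤i))) ⟩
    b * 1# + a * sum {N} (λ j → coeff f (suc (toℕ j ℕ.* 2)) * a ^ toℕ j)
      ≈⟨ +-congˡ (*-distribˡ-sum {N} a _) ⟩
    b * 1# + sum {N} (λ j → a * (coeff f (suc (toℕ j ℕ.* 2)) * a ^ toℕ j))
      ≈⟨ +-congˡ (sum-cong-≋ {N} λ j → x∙yz≈y∙xz _ _ _) ⟩
    b * 1# + sum {N} (λ j → coeff f (suc (toℕ j ℕ.* 2)) * (a * a ^ toℕ j))
      ∎
    where open CommutativeSemigroupProperties *-commutativeSemigroup using (x∙yz≈y∙xz)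
  odd-∑ N []      f≈0 = even-∑ N [] (λ _ _ → refl)
  odd-∑ N (b ∷ f) f≈0 = even-∑ N f (λ i N≤i → f≈0 (suc i) (s≤s N≤i))

-- Index arithmetic for the reversal j ↦ n - 1 - j.

suc-toℕ+opposite : ∀ {n} (i : Fin n) → suc (toℕ i) ℕ.+ toℕ (opposite i) ≡ n
suc-toℕ+opposite i =
  ≡.trans (≡.cong (suc (toℕ i) ℕ.+_) (Fin.opposite-prop i)) (ℕ.m+[n∸m]≡n (Fin.toℕ<n i))

n+n≡n*2 : ∀ n → n ℕ.+ n ≡ n ℕ.* 2
n+n≡n*2 n = ≡.trans (≡.cong (n ℕ.+_) (≡.sym (ℕ.+-identityʳ n))) (ℕ.*-comm 2 n)

-- Cancellation in fields, and the characteristic of a finite field.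

module FieldProperties (F : Field c ℓ) where
  open Field F hiding (zero)
  open Exponentiation semiring using (_^_)
  open GroupProperties +-group using (x∙y⁻¹≈ε⇒x≈y)
  open RingProperties ring using (-‿distribʳ-*)
  open Multiples +-monoid using (×-congˡ) renaming (_×_ to _·_)
  open Sums +-commutativeMonoid using (sum; sum-permute; sum-cong-≋; ∑-distrib-+; sum-replicate)
  open SemiringMultiples semiring using (×1-homo-*)
  open SemiringSolver commutativeSemiring using (solve; _:=_; _:+_; _:*_)
  open SetoidReasoning setoid

  *-cancelˡ-≉0 : ∀ {x y z} → x ≉ 0# → x * y ≈ x * z → y ≈ z
  *-cancelˡ-≉0 {x} {y} {z} x≉0 xy≈xz with invertible x≉0
  ... | x⁻¹ , x⁻¹x≈1 , _ = begin
    y              ≈⟨ x⁻¹xw≈w y ⟨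
    x⁻¹ * (x * y)  ≈⟨ *-congˡ xy≈xz ⟩
    x⁻¹ * (x * z)  ≈⟨ x⁻¹xw≈w z ⟩
    z              ∎
    where
    x⁻¹xw≈w : ∀ w → x⁻¹ * (x * w) ≈ w
    x⁻¹xw≈w w = trans (sym (*-assoc x⁻¹ x w)) (trans (*-congʳ x⁻¹x≈1) (*-identityˡ w))

  x*y≈0⇒y≈0 : ∀ {x y} → x ≉ 0# → x * y ≈ 0# → y ≈ 0#
  x*y≈0⇒y≈0 x≉0 xy≈0 = *-cancelˡ-≉0 x≉0 (trans xy≈0 (sym (zeroʳ _)))

  ^-≉0 : ∀ {x} → x ≉ 0# → ∀ n → x ^ n ≉ 0#
  ^-≉0 x≉0 zero    = 1≉0
  ^-≉0 x≉0 (suc n) = ^-≉0 x≉0 n ∘ x*y≈0⇒y≈0 x≉0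

  x+x≈0⇒x≈0 : 1# + 1# ≉ 0# → ∀ {x} → x + x ≈ 0# → x ≈ 0#
  x+x≈0⇒x≈0 2≉0 {x} x+x≈0 = x*y≈0⇒y≈0 2≉0 (begin
    (1# + 1#) * x    ≈⟨ distribʳ x 1# 1# ⟩
    1# * x + 1# * x  ≈⟨ +-cong (*-identityˡ x) (*-identityˡ x) ⟩
    x + x            ≈⟨ x+x≈0 ⟩
    0#               ∎)

  x²≈y²⇒x≈±y : Decidable _≈_ → ∀ {x y} → x * x ≈ y * y → x ≈ y ⊎ x + y ≈ 0#
  x²≈y²⇒x≈±y _≟_ {x} {y} x²≈y² with x ≟ y
  ... | yes x≈y = inj₁ x≈y
  ... | no  x≉y = inj₂ (x*y≈0⇒y≈0 (x≉y ∘ x∙y⁻¹≈ε⇒x≈y x y) (begin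
    (x - y) * (x + y)
      -- The solver handles semirings only, so -y enters as an atom z and the terms are grouped to
      -- expose y + z.
      ≈⟨ solve 3 (λ x y z → (x :+ z) :* (x :+ y) := x :* x :+ x :* (y :+ z) :+ y :* z) refl x y (- y) ⟩
    x * x + x * (y - y) + y * - y
      ≈⟨ +-cong (+-cong x²≈y² (trans (*-congˡ (-‿inverseʳ y)) (zeroʳ x))) (sym (-‿distribʳ-* y y)) ⟩
    y * y + 0# - y * y
      ≈⟨ +-congʳ (+-identityʳ _) ⟩
    y * y - y * y
      ≈⟨ -‿inverseʳ _ ⟩
    0#
      ∎))

  module _ {q} (card : HasCardinality F q) where
    open Inverse card using (to; from; to-cong; strictlyInverseˡ; strictlyInverseʳ)

    ≈-dec : Decidable _≈_
    ≈-dec = Dec.via-injection (Inverse⇒Injection card) Fin._≟_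

    -- Translation by 1 permutes F, so the sum of all elements equals itself plus q · 1.
    card·1≈0 : q · 1# ≈ 0#
    card·1≈0 = +-cancelˡ (sum from) (q · 1#) 0# (begin
      sum from + q · 1#                ≈⟨ +-congˡ (sum-replicate q) ⟨
      sum from + sum {q} (λ _ → 1#)    ≈⟨ ∑-distrib-+ from (λ _ → 1#) ⟨
      sum (λ i → from i + 1#)          ≈⟨ sum-cong-≋ (λ i → strictlyInverseʳ (from i + 1#)) ⟨
      sum (λ i → from (translate 1# i)) ≈⟨ sum-permute from
                                            (permutation (translate 1#) (translate (- 1#))
                                              (translate-inverse 1# (- 1#) (-‿inverseˡ 1#))
                                              (translate-inverse (- 1#) 1# (-‿inverseʳ 1#))) ⟨
      sum from                         ≈⟨ +-identityʳ _ ⟨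
      sum from + 0#                    ∎)
      where
      open GroupProperties +-group using () renaming (∙-cancelˡ to +-cancelˡ)
      translate : Carrier → Fin q → Fin q
      translate x i = to (from i + x)
      translate-inverse : ∀ x y → y + x ≈ 0# → ∀ i → translate x (translate y i) ≡ i
      translate-inverse x y y+x≈0 i = ≡.trans (to-cong (begin
        from (to (from i + y)) + x  ≈⟨ +-congʳ (strictlyInverseʳ _) ⟩
        from i + y + x              ≈⟨ +-assoc _ y x ⟩
        from i + (y + x)            ≈⟨ +-congˡ y+x≈0 ⟩
        from i + 0#                 ≈⟨ +-identityʳ _ ⟩
        from i                      ∎)) (strictlyInverseˡ i)

    -- Write q = 1 + 2r. If 1 + 1 = 0, then 0 = q · 1 = 1 + r · (1 + 1) = 1.
    odd-card⇒2≉0 : 2 ∤ q → 1# + 1# ≉ 0#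
    odd-card⇒2≉0 2∤q 2≈0 with q ℕ/.% 2 in q%2≡ | ℕ/.m%n<n q 2
    ... | 0           | _ = 2∤q (ℕ∣.m%n≡0⇒n∣m q 2 q%2≡)
    ... | 1           | _ = 1≉0 (begin
      1#
        ≈⟨ +-identityʳ 1# ⟨
      1# + 0#
        ≈⟨ +-congˡ (zeroʳ _) ⟨
      1# + (q ℕ/./ 2) · 1# * 0#
        ≈⟨ +-congˡ (*-congˡ (trans (+-congˡ (+-identityʳ 1#)) 2≈0)) ⟨
      1# + (q ℕ/./ 2) · 1# * 2 · 1#
        ≈⟨ +-congˡ (×1-homo-* (q ℕ/./ 2) 2) ⟨
      suc (q ℕ/./ 2 ℕ.* 2) · 1#
        ≈⟨ ×-congˡ (≡.trans (ℕ/.m≡m%n+[m/n]*n q 2) (≡.cong (ℕ._+ q ℕ/./ 2 ℕ.* 2) q%2≡)) ⟨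
      q · 1#
        ≈⟨ card·1≈0 ⟩
      0#
        ∎)
    ... | suc (suc _) | s≤s (s≤s ())

-- Self-reciprocity as a reflection law on coefficients.

module SelfReciprocalProperties (F : Field c ℓ) (a : Field.Carrier F) where
  open Field F hiding (zero)
  open SelfReciprocal F
  open PolynomialProperties commutativeRing
  open DivisionByX²-a commutativeRing a
  open FieldProperties F
  open Exponentiation semiring using (_^_; ^-homo-*; ^-congʳ)
  open GroupProperties +-group using () renaming (∙-cancelˡ to +-cancelˡ)
  open Sums +-commutativeMonoid using (sum; sum-permute; sum-cong-≋; ∑-distrib-+; sum-replicate-zero)
  open SemiringSolver commutativeSemiring using (solve; _:=_; _:+_; _:*_)
  open SetoidReasoning setoid

  coeff-reciprocal : ∀ n f (f₀≉0 : coeff f 0 ≉ 0#) i j → i ℕ.+ j ≡ n →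
    coeff f 0 * coeff (reciprocal a n f f₀≉0) j ≈ coeff f i * a ^ i
  coeff-reciprocal n f f₀≉0 i j i+j≡n with invertible f₀≉0
  ... | f₀⁻¹ , _ , f₀f₀⁻¹≈1 = begin
    coeff f 0 * coeff (C f₀⁻¹ *ₚ s) j      ≈⟨ *-congˡ (coeff-C* f₀⁻¹ s j) ⟩
    coeff f 0 * (f₀⁻¹ * coeff s j)         ≈⟨ *-assoc _ f₀⁻¹ _ ⟨
    coeff f 0 * f₀⁻¹ * coeff s j           ≈⟨ *-congʳ f₀f₀⁻¹≈1 ⟩
    1# * coeff s j                         ≈⟨ *-identityˡ _ ⟩
    coeff s j                              ≈⟨ coeff-∑CX^ n (λ k → coeff f k * a ^ k) i j i+j≡n ⟩
    coeff f i * a ^ i                      ∎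
    where s = sumₚ {suc n} (λ k → C (coeff f (toℕ k) * a ^ toℕ k) *ₚ X ^ₚ (n ∸ toℕ k))

  coeff-reciprocal-> : ∀ n f (f₀≉0 : coeff f 0 ≉ 0#) j → n < j →
    coeff (reciprocal a n f f₀≉0) j ≈ 0#
  coeff-reciprocal-> n f f₀≉0 j n<j =
    trans (coeff-C* _ (sumₚ {suc n} (λ k → C (coeff f (toℕ k) * a ^ toℕ k) *ₚ X ^ₚ (n ∸ toℕ k))) j)
          (trans (*-congˡ (coeff-∑CX^-> n (λ k → coeff f k * a ^ k) j n<j)) (zeroʳ _))

  -- Compare coefficients of xʲ and clear the factor 1 / f₀. Later arguments work with this law and
  -- its converse instead of `reciprocal`.
  reflection : ∀ {n f} → SelfReciprocalMonic a n f → ∀ i j → i ℕ.+ j ≡ n →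
    coeff f i * a ^ i ≈ coeff f 0 * coeff f j
  reflection {n} {f} sr i j i+j≡n =
    trans (sym (coeff-reciprocal n f f[0]≉0 i j i+j≡n)) (*-congˡ (selfReciprocal j))
    where open SelfReciprocalMonic sr

  reflection⇒selfReciprocal : ∀ {n f} → MonicOfDegree n f → coeff f 0 ≉ 0# →
    (∀ i j → i ℕ.+ j ≡ n → coeff f i * a ^ i ≈ coeff f 0 * coeff f j) →
    SelfReciprocalMonic a n f
  reflection⇒selfReciprocal {n} {f} monic f₀≉0 refl-eq = record
    { monic          = monic
    ; f[0]≉0         = f₀≉0
    ; selfReciprocal = recip
    }
    where
    recip : reciprocal a n f f₀≉0 ≈ₚ f
    recip j with j ℕ.≤? n
    ... | yes j≤n = *-cancelˡ-≉0 f₀≉0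
      (trans (coeff-reciprocal n f f₀≉0 (n ∸ j) j (ℕ.m∸n+n≡m j≤n))
             (refl-eq (n ∸ j) j (ℕ.m∸n+n≡m j≤n)))
    ... | no  j≰n = trans (coeff-reciprocal-> n f f₀≉0 j (ℕ.≰⇒> j≰n))
                          (sym (MonicOfDegree.above monic j (ℕ.≰⇒> j≰n)))

  -- f₀ ² = aⁿ is the instance i = n of the reflection law.
  constant≈±a^m : Decidable _≈_ → ∀ {m f} → SelfReciprocalMonic a (2 ℕ.* m) f →
    coeff f 0 ≈ a ^ m ⊎ coeff f 0 + a ^ m ≈ 0#
  constant≈±a^m _≟_ {m} {f} sr = x²≈y²⇒x≈±y _≟_ (begin
    coeff f 0 * coeff f 0                    ≈⟨ reflection sr (2 ℕ.* m) 0 (ℕ.+-identityʳ _) ⟨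
    coeff f (2 ℕ.* m) * a ^ (2 ℕ.* m)        ≈⟨ *-congʳ (MonicOfDegree.leading (SelfReciprocalMonic.monic sr)) ⟩
    1# * a ^ (2 ℕ.* m)                       ≈⟨ *-identityˡ _ ⟩
    a ^ (m ℕ.+ (m ℕ.+ 0))                    ≈⟨ ^-congʳ a (≡.cong (m ℕ.+_) (ℕ.+-identityʳ m)) ⟩
    a ^ (m ℕ.+ m)                            ≈⟨ ^-homo-* a m m ⟩
    a ^ m * a ^ m                            ∎)

  -- Adding the sum to its reversal gives 2 ∑ t = 0. A middle term paired with itself is covered
  -- too, since 2 is cancelled only at the end.
  sum-antisymmetric : 1# + 1# ≉ 0# → ∀ N (t : Fin N → Carrier) →
    (∀ i → t i + t (opposite i) ≈ 0#) → sum t ≈ 0#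
  sum-antisymmetric 2≉0 N t anti = x+x≈0⇒x≈0 2≉0 (begin
    sum t + sum t                      ≈⟨ +-congˡ (sum-permute t reverse) ⟩
    sum t + sum (t ∘ opposite)         ≈⟨ ∑-distrib-+ t (t ∘ opposite) ⟨
    sum (λ i → t i + t (opposite i))   ≈⟨ sum-cong-≋ anti ⟩
    sum {N} (λ _ → 0#)                 ≈⟨ sum-replicate-zero N ⟩
    0#                                 ∎)

  -- Trivial polynomials are divisible by x² - a.

  module _ (a≉0 : a ≉ 0#) where

    -- The reflection law divided by aˢ.
    trivial-antisymmetry : ∀ {m n f} → SelfReciprocalMonic a n f → coeff f 0 + a ^ m ≈ 0# →
      ∀ i j s t t′ → i ℕ.+ j ≡ n → s ℕ.+ t ≡ i → s ℕ.+ t′ ≡ m →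
      coeff f i * a ^ t + coeff f j * a ^ t′ ≈ 0#
    trivial-antisymmetry {m} {n} {f} sr f₀≈-a^m i j s t t′ i+j≡n ≡.refl ≡.refl =
      x*y≈0⇒y≈0 (^-≉0 a≉0 s) (begin
        a ^ s * (coeff f i * a ^ t + coeff f j * a ^ t′)
          ≈⟨ solve 5 (λ s t t′ x y → s :* (x :* t :+ y :* t′) := x :* (s :* t) :+ s :* t′ :* y)
               refl (a ^ s) (a ^ t) (a ^ t′) (coeff f i) (coeff f j) ⟩
        coeff f i * (a ^ s * a ^ t) + a ^ s * a ^ t′ * coeff f j
          ≈⟨ +-cong (*-congˡ (^-homo-* a s t)) (*-congʳ (^-homo-* a s t′)) ⟨
        coeff f i * a ^ i + a ^ m * coeff f j
          ≈⟨ +-congʳ (reflection sr i j i+j≡n) ⟩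
        coeff f 0 * coeff f j + a ^ m * coeff f j
          ≈⟨ distribʳ (coeff f j) _ _ ⟨
        (coeff f 0 + a ^ m) * coeff f j
          ≈⟨ *-congʳ f₀≈-a^m ⟩
        0# * coeff f j
          ≈⟨ zeroˡ _ ⟩
        0#
          ∎)

    trivial⇒even≈0 : 1# + 1# ≉ 0# → ∀ {m f} → SelfReciprocalMonic a (2 ℕ.* m) f →
      coeff f 0 + a ^ m ≈ 0# → even f ≈ 0#
    trivial⇒even≈0 2≉0 {m} {f} sr f₀≈-a^m = trans
      (even-∑ (suc m) f λ i 2m<i → MonicOfDegree.above monic i
        (ℕ.<-trans (ℕ.n<1+n _) (≡.subst (λ k → suc (suc k) ≤ i) (ℕ.*-comm m 2) 2m<i)))
      (sum-antisymmetric 2≉0 (suc m) _ λ j →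
        -- Here 2j = j + j and m = j + (m - j), so division by aʲ leaves the weights aʲ and aᵐ⁻ʲ of
        -- the terms j and m - j. There are m + 1 terms, since the exponent 2m is included.
        trivial-antisymmetry sr f₀≈-a^m (toℕ j ℕ.* 2) (toℕ (opposite j) ℕ.* 2)
          (toℕ j) (toℕ j) (toℕ (opposite j))
          (≡.trans (≡.sym (ℕ.*-distribʳ-+ 2 (toℕ j) _))
                   (≡.trans (≡.cong (ℕ._* 2) (ℕ.suc-injective (suc-toℕ+opposite j))) (ℕ.*-comm m 2)))
          (n+n≡n*2 (toℕ j))
          (ℕ.suc-injective (suc-toℕ+opposite j)))
      where
      open SelfReciprocalMonic sr

    trivial⇒odd≈0 : 1# + 1# ≉ 0# → ∀ {m f} → SelfReciprocalMonic a (2 ℕ.* m) f →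
      coeff f 0 + a ^ m ≈ 0# → odd f ≈ 0#
    trivial⇒odd≈0 2≉0 {m} {f} sr f₀≈-a^m = trans
      (odd-∑ m f λ i 2m<i → MonicOfDegree.above monic i
        (≡.subst (λ k → suc k ≤ i) (ℕ.*-comm m 2) 2m<i))
      (sum-antisymmetric 2≉0 m _ λ j →
        -- Here 2j + 1 = (j + 1) + j and m = (j + 1) + (m - 1 - j), so the division is by aʲ⁺¹. The
        -- odd exponents 1, ..., 2m - 1 give only m terms.
        trivial-antisymmetry sr f₀≈-a^m (suc (toℕ j ℕ.* 2)) (suc (toℕ (opposite j) ℕ.* 2))
          (suc (toℕ j)) (toℕ j) (toℕ (opposite j))
          (≡.trans (≡.cong suc (ℕ.+-suc (toℕ j ℕ.* 2) _))
            (≡.trans (≡.cong (suc ∘ suc) (≡.sym (ℕ.*-distribʳ-+ 2 (toℕ j) _)))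
              (≡.trans (≡.cong (ℕ._* 2) (suc-toℕ+opposite j)) (ℕ.*-comm m 2))))
          (≡.cong suc (n+n≡n*2 (toℕ j)))
          (suc-toℕ+opposite j))
      where
      open SelfReciprocalMonic sr

    trivial-divisible : 1# + 1# ≉ 0# → ∀ {m f} → SelfReciprocalMonic a (2 ℕ.* m) f →
      coeff f 0 + a ^ m ≈ 0# → f ≈X²-a* quotient f
    trivial-divisible 2≉0 {m} {f} sr f₀≈-a^m =
      quotient-exact f (trivial⇒even≈0 2≉0 {m} sr f₀≈-a^m) (trivial⇒odd≈0 2≉0 {m} sr f₀≈-a^m)

    -- Quotients of self-reciprocal polynomials by x² - a.

    quotient-vanishes : ∀ {d f g} → MonicOfDegree (suc d) f → f ≈X²-a* g →
      ∀ i → d ≤ i → coeff g i ≈ 0#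
    quotient-vanishes {d} {f} {g} monic f≈ = eventually-zero g d λ i d≤i → begin
      coeff g i                                      ≈⟨ equation f≈ (2 ℕ.+ i) ⟨
      coeff f (2 ℕ.+ i) + a * coeff g (2 ℕ.+ i)      ≈⟨ +-congʳ (MonicOfDegree.above monic (2 ℕ.+ i) (s≤s (s≤s d≤i))) ⟩
      0# + a * coeff g (2 ℕ.+ i)                     ≈⟨ +-identityˡ _ ⟩
      a * coeff g (2 ℕ.+ i)                          ∎

    quotient-constant≉0 : ∀ {f g} → coeff f 0 ≉ 0# → f ≈X²-a* g → coeff g 0 ≉ 0#
    quotient-constant≉0 {f} {g} f₀≉0 f≈ g₀≈0 = f₀≉0 (begin
      coeff f 0                  ≈⟨ +-identityʳ _ ⟨
      coeff f 0 + 0#             ≈⟨ +-congˡ (zeroʳ a) ⟨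
      coeff f 0 + a * 0#         ≈⟨ +-congˡ (*-congˡ g₀≈0) ⟨
      coeff f 0 + a * coeff g 0  ≈⟨ equation f≈ 0 ⟩
      0#                         ∎)

    quotient-monic : ∀ {d f g} → MonicOfDegree (2 ℕ.+ d) f → f ≈X²-a* g → MonicOfDegree d g
    quotient-monic {d} {f} {g} monic f≈ = record
      { leading = begin
          coeff g d                                   ≈⟨ equation f≈ (2 ℕ.+ d) ⟨
          coeff f (2 ℕ.+ d) + a * coeff g (2 ℕ.+ d)   ≈⟨ +-cong (MonicOfDegree.leading monic)
                                                           (*-congˡ (above (2 ℕ.+ d) (ℕ.m≤n+m (suc d) 1))) ⟩
          1# + a * 0#                                 ≈⟨ +-congˡ (zeroʳ a) ⟩
          1# + 0#                                     ≈⟨ +-identityʳ 1# ⟩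
          1#                                          ∎
      ; above   = above
      }
      where above = quotient-vanishes monic f≈

    -- Induction on i in steps of two. Substituting fᵢ = gᵢ₋₂ - a gᵢ, f₀ = -a g₀ and fⱼ₊₂ = gⱼ - a
    -- gⱼ₊₂ into the law of f at (i, j + 2) reduces the law of g at (i, j) to a² times its law at (i
    -- - 2, j + 2). For i = 0 the law says that g is monic.
    quotient-reflection : ∀ {d f g} → SelfReciprocalMonic a (2 ℕ.+ d) f → f ≈X²-a* g →
      ∀ i j → i ℕ.+ j ≡ d → coeff g i * a ^ i ≈ coeff g 0 * coeff g j
    quotient-reflection {d} {f} {g} sr f≈ zero j ≡.refl =
      *-congˡ (sym (MonicOfDegree.leading (quotient-monic (SelfReciprocalMonic.monic sr) f≈)))
    quotient-reflection {d} {f} {g} sr f≈ (suc i) j i+j≡d =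
      *-cancelˡ-≉0 a≉0 (+-cancelˡ (coeff f (suc i) * a ^ suc i) _ _ (begin
        coeff f (suc i) * a ^ suc i + a * (coeff g (suc i) * a ^ suc i)
          ≈⟨ solve 4 (λ x a y p → x :* p :+ a :* (y :* p) := (x :+ a :* y) :* p)
               refl (coeff f (suc i)) a (coeff g (suc i)) (a ^ suc i) ⟩
        (coeff f (suc i) + a * coeff g (suc i)) * a ^ suc i
          ≈⟨ *-congʳ (equation f≈ (suc i)) ⟩
        coeff (0# ∷ g) i * a ^ suc i
          ≈⟨ shifted i i+j≡d ⟩
        g₀ * (a * (a * g₂₊ⱼ))
          ≈⟨ +-identityˡ _ ⟨
        0# + g₀ * (a * (a * g₂₊ⱼ))
          -- The zero becomes (f₀ + a g₀) f₂₊ⱼ, which uses f₀ = -a g₀ without negation.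
          ≈⟨ +-congʳ (trans (*-congʳ (equation f≈ 0)) (zeroˡ _)) ⟨
        (coeff f 0 + a * g₀) * f₂₊ⱼ + g₀ * (a * (a * g₂₊ⱼ))
          ≈⟨ solve 5 (λ f₀ a g₀ x y → (f₀ :+ a :* g₀) :* x :+ g₀ :* (a :* (a :* y))
                                   := f₀ :* x :+ a :* (g₀ :* (x :+ a :* y)))
               refl (coeff f 0) a g₀ f₂₊ⱼ g₂₊ⱼ ⟩
        coeff f 0 * f₂₊ⱼ + a * (g₀ * (f₂₊ⱼ + a * g₂₊ⱼ))
          ≈⟨ +-cong (reflection sr (suc i) (2 ℕ.+ j) 1+i+2+j≡2+d) (*-congˡ (*-congˡ (sym (equation f≈ (2 ℕ.+ j))))) ⟨
        coeff f (suc i) * a ^ suc i + a * (g₀ * coeff g j)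
          ∎))
      where
      g₀ = coeff g 0
      f₂₊ⱼ = coeff f (2 ℕ.+ j)
      g₂₊ⱼ = coeff g (2 ℕ.+ j)
      1+i+2+j≡2+d : suc i ℕ.+ (2 ℕ.+ j) ≡ 2 ℕ.+ d
      1+i+2+j≡2+d = ≡.trans (ℕ.+-suc (suc i) (suc j))
        (≡.cong suc (≡.trans (ℕ.+-suc (suc i) j) (≡.cong suc i+j≡d)))
      -- At exponent 1 there is no gᵢ₋₂, and gⱼ₊₂ lies above the degree of g, so both sides vanish;
      -- beyond that the induction hypothesis applies.
      shifted : ∀ i → suc i ℕ.+ j ≡ d → coeff (0# ∷ g) i * a ^ suc i ≈ g₀ * (a * (a * g₂₊ⱼ))
      shifted zero 1+j≡d = begin
        0# * a ^ 1                  ≈⟨ zeroˡ _ ⟩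
        0#                          ≈⟨ zeroʳ _ ⟨
        g₀ * 0#                     ≈⟨ *-congˡ (trans (*-congˡ (zeroʳ a)) (zeroʳ a)) ⟨
        g₀ * (a * (a * 0#))         ≈⟨ *-congˡ (*-congˡ (*-congˡ (MonicOfDegree.above
                                         (quotient-monic (SelfReciprocalMonic.monic sr) f≈) (2 ℕ.+ j)
                                         (s≤s (ℕ.≤-reflexive (≡.sym 1+j≡d)))))) ⟨
        g₀ * (a * (a * g₂₊ⱼ))       ∎
      shifted (suc k) 2+k+j≡d = begin
        coeff g k * (a * (a * a ^ k))
          ≈⟨ solve 3 (λ x a p → x :* (a :* (a :* p)) := a :* (a :* (x :* p))) refl (coeff g k) a (a ^ k) ⟩
        a * (a * (coeff g k * a ^ k))
          ≈⟨ *-congˡ (*-congˡ (quotient-reflection sr f≈ k (2 ℕ.+ j)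
               (≡.trans (ℕ.+-suc k (suc j)) (≡.trans (≡.cong suc (ℕ.+-suc k j)) 2+k+j≡d)))) ⟩
        a * (a * (g₀ * g₂₊ⱼ))
          ≈⟨ solve 3 (λ x a y → a :* (a :* (x :* y)) := x :* (a :* (a :* y))) refl g₀ a g₂₊ⱼ ⟩
        g₀ * (a * (a * g₂₊ⱼ))
          ∎

    quotient-selfReciprocal : ∀ {d f g} → SelfReciprocalMonic a (2 ℕ.+ d) f → f ≈X²-a* g →
      SelfReciprocalMonic a d g
    quotient-selfReciprocal {f = f} sr f≈ = reflection⇒selfReciprocal
      (quotient-monic monic f≈) (quotient-constant≉0 {f} f[0]≉0 f≈) (quotient-reflection sr f≈)
      where open SelfReciprocalMonic sr

    quotient-selfReciprocal-2* : ∀ {m f g} → SelfReciprocalMonic a (2 ℕ.* suc m) f → f ≈X²-a* g →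
      SelfReciprocalMonic a (2 ℕ.* m) g
    quotient-selfReciprocal-2* {m} {f} sr = quotient-selfReciprocal
      (≡.subst (λ n → SelfReciprocalMonic a n f) (ℕ.*-suc 2 m) sr)

    -- For constant f the equation gives gᵢ = a gᵢ₊₂ for every i, so g = 0, against g₀ ≠ 0. This
    -- stops the repeated division.
    degree-0-indivisible : ∀ {f g} → SelfReciprocalMonic a 0 f → ¬ f ≈X²-a* g
    degree-0-indivisible {f} {g} sr f≈ = quotient-constant≉0 {f} f[0]≉0 f≈ (begin
      coeff g 0                      ≈⟨ eventually-zero g 0 (λ i _ → trans (sym (equation f≈ (2 ℕ.+ i)))
                                          (trans (+-congʳ (MonicOfDegree.above monic (2 ℕ.+ i) (s≤s z≤n)))
                                                 (+-identityˡ _))) 0 z≤n ⟩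
      0#                             ∎)
      where open SelfReciprocalMonic sr

    -- This lemma and the next read the sign change off f₀ + a g₀ = 0 and cancel one factor a.
    nontrivial⇒quotient-trivial : ∀ {m f g} → f ≈X²-a* g → coeff f 0 ≈ a ^ suc m → coeff g 0 + a ^ m ≈ 0#
    nontrivial⇒quotient-trivial {m} {f} {g} f≈ f₀≈a^m = x*y≈0⇒y≈0 a≉0 (begin
      a * (coeff g 0 + a ^ m)        ≈⟨ distribˡ a _ _ ⟩
      a * coeff g 0 + a ^ suc m      ≈⟨ +-comm _ _ ⟩
      a ^ suc m + a * coeff g 0      ≈⟨ +-congʳ f₀≈a^m ⟨
      coeff f 0 + a * coeff g 0      ≈⟨ equation f≈ 0 ⟩
      0#                             ∎)

    trivial⇒quotient-nontrivial : ∀ {m f g} → f ≈X²-a* g → coeff f 0 + a ^ suc m ≈ 0# → coeff g 0 ≈ a ^ m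
    trivial⇒quotient-nontrivial {f = f} f≈ f₀+a^m≈0 =
      *-cancelˡ-≉0 a≉0 (+-cancelˡ (coeff f 0) _ _ (trans (equation f≈ 0) (sym f₀+a^m≈0)))

    -- Equal degrees force equal m, and then aᵐ = -aᵐ gives 2 aᵐ = 0. Hence only one of the two
    -- parity claims is ever substantive.
    trivial-nontrivial-exclusive : 1# + 1# ≉ 0# → ∀ {f} → Trivial a f → ¬ Nontrivial a f
    trivial-nontrivial-exclusive 2≉0 {f} (m , sr , f₀≈-a^m) (m′ , sr′ , f₀≈a^m′)
      with ℕ.*-cancelˡ-≡ m m′ 2 (monic-degree-unique 1≉0 {f = f}
             (SelfReciprocalMonic.monic sr) (SelfReciprocalMonic.monic sr′))
    ... | ≡.refl = ^-≉0 a≉0 m (x+x≈0⇒x≈0 2≉0 (begin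
      a ^ m + a ^ m    ≈⟨ +-congˡ (trans (sym f₀≈a^m′) f₀≈-a^m) ⟩
      a ^ m - a ^ m    ≈⟨ -‿inverseʳ _ ⟩
      0#               ∎))

    -- Repeated division by x² - a.

    record Factorisation (k : ℕ) (f : Poly) : Set (c ⊔ ℓ) where
      field
        cofactor    : Poly
        factors     : f ≈ₚ X²-a ^ₚ k *ₚ cofactor
        nontrivial  : Nontrivial a cofactor
        indivisible : X²-a ∤ₚ cofactor

    factorisation-zero : ∀ {f} → Nontrivial a f → X²-a ∤ₚ f → Factorisation 0 f
    factorisation-zero {f} nontrivial ∤f = record
      { cofactor    = f
      ; factors     = λ i → sym (trans (coeff-C* 1# f i) (*-identityˡ _))
      ; nontrivial  = nontrivial
      ; indivisible = ∤f
      }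

    factorisation-suc : ∀ {k f g} → f ≈X²-a* g → Factorisation k g → Factorisation (suc k) f
    factorisation-suc {k} {f} {g} f≈ fact = record
      { cofactor    = cofactor
      ; factors     = λ i → begin
          coeff f i                                      ≈⟨ ≈X²-a*⇒≈ f≈ i ⟩
          coeff (X²-a *ₚ g) i                            ≈⟨ *ₚ-congˡ X²-a {g} {X²-a ^ₚ k *ₚ cofactor} factors i ⟩
          coeff (X²-a *ₚ (X²-a ^ₚ k *ₚ cofactor)) i      ≈⟨ *ₚ-assoc X²-a (X²-a ^ₚ k) cofactor i ⟨
          coeff (X²-a *ₚ X²-a ^ₚ k *ₚ cofactor) i        ∎
      ; nontrivial  = nontrivial
      ; indivisible = indivisible
      }
      where open Factorisation fact

    module _ (_≟_ : Decidable _≈_) (2≉0 : 1# + 1# ≉ 0#) where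

      -- Mutual recursion on the half-degree m, as each division switches the type. The process may
      -- stop only at a nontrivial polynomial; a trivial one is always divided once more, whence the
      -- exponent `suc k`.
      factor-nontrivial : ∀ m f → SelfReciprocalMonic a (2 ℕ.* m) f → coeff f 0 ≈ a ^ m →
        ∃[ k ] 2 ∣ k × Factorisation k f
      factor-trivial : ∀ m f → SelfReciprocalMonic a (2 ℕ.* m) f → coeff f 0 + a ^ m ≈ 0# →
        ∃[ k ] 2 ∣ k × Factorisation (suc k) f

      factor-nontrivial m f sr f₀≈a^m with X²-a∣? _≟_ f
      factor-nontrivial m f sr f₀≈a^m | inj₂ ∤f =
        0 , divides 0 ≡.refl , factorisation-zero (m , sr , f₀≈a^m) ∤f
      factor-nontrivial zero f sr f₀≈a^m | inj₁ (g , f≈) =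
        contradiction f≈ (degree-0-indivisible {f} sr)
      factor-nontrivial (suc m) f sr f₀≈a^m | inj₁ (g , f≈) =
        -- The trivial quotient has exponent `suc k` with k even, so the exponent for f is 2 + k.
        Product.map (2 ℕ.+_) (Product.map (ℕ∣.∣m∣n⇒∣m+n ℕ∣.∣-refl) (factorisation-suc f≈))
          (factor-trivial m g (quotient-selfReciprocal-2* sr f≈)
            (nontrivial⇒quotient-trivial {m} {f} f≈ f₀≈a^m))

      factor-trivial zero f sr f₀≈-a^m =
        -- A trivial polynomial of degree 0 would be a constant divisible by x² - a.
        contradiction (trivial-divisible 2≉0 {0} sr f₀≈-a^m) (degree-0-indivisible {f} sr)
      factor-trivial (suc m) f sr f₀≈-a^m = Product.map₂ (Product.map₂ (factorisation-suc f≈))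
        (factor-nontrivial m (quotient f) (quotient-selfReciprocal-2* sr f≈)
          (trivial⇒quotient-nontrivial {m} {f} f≈ f₀≈-a^m))
        where f≈ = trivial-divisible 2≉0 {suc m} sr f₀≈-a^m

-- Parity of the exponent and the theorem.

2∣n⇒2∤1+n : ∀ {n} → 2 ∣ n → 2 ∤ suc n
2∣n⇒2∤1+n {n} 2∣n 2∣1+n with ℕ∣.∣1⇒≡1 (ℕ∣.∣m+n∣m⇒∣n (≡.subst (2 ∣_) (ℕ.+-comm 1 n) 2∣1+n) 2∣n)
... | ()

theorem3 : ∀ {c ℓ} (q : ℕ) → OddPrimePower q →
    (F : Field c ℓ) → HasCardinality F q →
    let open Field F
        open SelfReciprocal F
    in (a : Carrier) → a ≉ 0# →
       (f : Poly) (n : ℕ) → 2 ∣ n → SelfReciprocalMonic a n f →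
       ∃[ k ] ∃[ g ]
         f ≈ₚ (X ^ₚ 2 -ₚ C a) ^ₚ k *ₚ g ×
         Nontrivial a g ×
         (X ^ₚ 2 -ₚ C a) ∤ₚ g ×
         (Trivial a f → 2 ∤ k) ×
         (Nontrivial a f → 2 ∣ k)
theorem3 {c} {ℓ} q (_ , 2∤q) F card a a≉0 f _ (divides m ≡.refl) sr =
  conclude (constant≈±a^m (≈-dec card) {m} sr′)
  where
  open Field F hiding (zero)
  open SelfReciprocal F
  open FieldProperties F
  open SelfReciprocalProperties F a
  open Factorisation
  open DivisionByX²-a commutativeRing a using (X²-a)
  open Exponentiation semiring using (_^_)
  open GroupProperties +-group using (inverseˡ-unique)

  2≉0 : 1# + 1# ≉ 0#
  2≉0 = odd-card⇒2≉0 card 2∤q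

  sr′ : SelfReciprocalMonic a (2 ℕ.* m) f
  sr′ = ≡.subst (λ n → SelfReciprocalMonic a n f) (ℕ.*-comm m 2) sr

  exclusive : Trivial a f → ¬ Nontrivial a f
  exclusive = trivial-nontrivial-exclusive a≉0 2≉0

  conclude : coeff f 0 ≈ a ^ m ⊎ coeff f 0 + a ^ m ≈ 0# →
    ∃[ k ] ∃[ g ] f ≈ₚ X²-a ^ₚ k *ₚ g × Nontrivial a g × X²-a ∤ₚ g ×
      (Trivial a f → 2 ∤ k) × (Nontrivial a f → 2 ∣ k)
  conclude (inj₁ f₀≈a^m) =
    let k , 2∣k , fact = factor-nontrivial a≉0 (≈-dec card) 2≉0 m f sr′ f₀≈a^m
    in k , cofactor fact , factors fact , nontrivial fact , indivisible fact ,
       -- With f nontrivial, the claim about trivial f is vacuous; the other case is symmetric.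
       (λ trivial → contradiction (m , sr′ , f₀≈a^m) (exclusive trivial)) , (λ _ → 2∣k)
  conclude (inj₂ f₀+a^m≈0) =
    let k , 2∣k , fact = factor-trivial a≉0 (≈-dec card) 2≉0 m f sr′ f₀+a^m≈0
    in suc k , cofactor fact , factors fact , nontrivial fact , indivisible fact ,
       (λ _ → 2∣n⇒2∤1+n 2∣k) ,
       (λ nontriv → contradiction nontriv (exclusive (m , sr′ , inverseˡ-unique _ _ f₀+a^m≈0)))
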